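{- Let $p\ge 1$ be an integer. For integers $\ell,r\ge1$ such that $p$ divides $r$ and $p$ does not divide $\ell$, let $C_p(\ell,r)$ be the number of configurations of period $p$ of the canonical negative-positive double Boolean automata circuit $D_{\ell,r}$ (negative left-circuit of size $\ell$, positive right-circuit of size $r$). Then $C_p(\ell,r)$ depends only on $\Delta_p=\gcd(\ell,p)$ and on $p$: if $(\ell,r)$ and $(\ell',r')$ are two such pairs with $\gcd(\ell,p)=\gcd(\ell',p)$, then $C_p(\ell,r)=C_p(\ell',r')$.
   Context: The canonical negative-positive double Boolean automata circuit $D_{\ell,r}$ has $n=\ell+r-1$ nodes $0,\ldots,n-1$. For a configuration $x=(x_0,\ldots,x_{n-1})\in\{0,1\}^n$ write $x^L=(x_0,\ldots,x_{\ell-1})$ (states of the left-circuit) and $x^R=(x_0,x_\ell,\ldots,x_{n-1})$ (states of the right-circuit, $r$ entries). All nodes are updated in parallel by $F:\{0,1\}^n\to\{0,1\}^n$: $F(x)_i=x_{i-1}$ for $i\notin\{0,\ell\}$; $F(x)_\ell=x_0$ (if $r\ge2$); and $F(x)_0=\neg a\vee b$, where $a=x_{\ell-1}$ is the last entry of $x^L$ and $b$ is the last entry of $x^R$ (so $b=x_{n-1}$ when $r\ge 2$). A configuration $x$ has period $p$ if $F^{p}(x)=x$; $p$ need not be minimal. -}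

module Defs where

open import Data.Bool using (Bool; true; false; not; _∨_; if_then_else_)
open import Data.Bool.Properties using () renaming (_≟_ to _≟ᵇ_)
open import Data.Fin using (Fin; zero; suc; toℕ; inject₁)
open import Data.List as List using (List; cartesianProductWith; filter; length)
open import Data.List.Membership.Propositional using (_∈_)
open import Data.List.Membership.Propositional.Properties
  using (∈-cartesianProductWith⁺)
open import Data.List.Relation.Unary.All as All using ()
open import Data.List.Relation.Unary.AllPairs as AllPairs using ()
open import Data.List.Relation.Unary.Any using (here; there)
open import Data.List.Relation.Unary.Unique.Propositional using (Unique)
open import Data.List.Relation.Unary.Unique.Propositional.Properties
  using (cartesianProductWith⁺)
open import Data.Nat using (ℕ; zero; suc; _+_; _∸_; _≡ᵇ_; NonZero)
open import Data.Nat.GeneralisedArithmetic using (iterate)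
open import Data.Vec using (Vec; []; _∷_; head; last; take; drop; lookup; tabulate)
open import Data.Vec.Properties using (≡-dec; ∷-injective)
open import Relation.Binary.PropositionalEquality using (_≡_; refl)
open import Relation.Nullary using (Dec)

-- The bracketing ℓ + (r ∸ 1) of ℓ + r - 1 makes the configuration split as
-- (x₀ … x_{ℓ-1}) followed by (x_ℓ … x_{n-1}).
Config : ℕ → ℕ → Set
Config ℓ r = Vec Bool (ℓ + (r ∸ 1))

left : ∀ ℓ r → Config ℓ r → Vec Bool ℓ
left ℓ r x = take ℓ x

-- Node 0 is shared by the two circuits.
right : ∀ ℓ r .{{_ : NonZero ℓ}} .{{_ : NonZero r}} → Config ℓ r → Vec Bool r
right (suc l) (suc k) x = head x ∷ drop (suc l) x

-- In the second clause of `next`, the node is 1 + toℕ j and its predecessor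
-- is `inject₁ j`.
F : ∀ ℓ r .{{_ : NonZero ℓ}} .{{_ : NonZero r}} → Config ℓ r → Config ℓ r
F (suc l) (suc k) x = tabulate next
  where
  next : Fin (suc l + k) → Bool
  next zero    = not (last (left (suc l) (suc k) x)) ∨ last (right (suc l) (suc k) x)
  next (suc j) = if suc (toℕ j) ≡ᵇ suc l then head x else lookup x (inject₁ j)

HasPeriod : ∀ (p ℓ r : ℕ) .{{_ : NonZero ℓ}} .{{_ : NonZero r}} → Config ℓ r → Set
HasPeriod p ℓ r x = iterate (F ℓ r) x p ≡ x

hasPeriod? : ∀ p ℓ r .{{_ : NonZero ℓ}} .{{_ : NonZero r}} (x : Config ℓ r) →
             Dec (HasPeriod p ℓ r x)
hasPeriod? p ℓ r x = ≡-dec _≟ᵇ_ (iterate (F ℓ r) x p) x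

bools : List Bool
bools = false List.∷ true List.∷ List.[]

allVecs : ∀ n → List (Vec Bool n)
allVecs zero    = [] List.∷ List.[]
allVecs (suc n) = cartesianProductWith _∷_ bools (allVecs n)

C : ∀ (p ℓ r : ℕ) .{{_ : NonZero ℓ}} .{{_ : NonZero r}} → ℕ
C p ℓ r = length (filter (hasPeriod? p ℓ r) (allVecs (ℓ + (r ∸ 1))))

-- `allVecs n` lists every vector exactly once, so `C` is a cardinality.

∈-bools : ∀ b → b ∈ bools
∈-bools false = here refl
∈-bools true  = there (here refl)

∈-allVecs : ∀ {n} (x : Vec Bool n) → x ∈ allVecs n
∈-allVecs []      = here refl
∈-allVecs (b ∷ x) = ∈-cartesianProductWith⁺ _∷_ (∈-bools b) (∈-allVecs x)

bools-unique : Unique bools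
bools-unique = ((λ ()) All.∷ All.[]) AllPairs.∷ All.[] AllPairs.∷ AllPairs.[]

allVecs-unique : ∀ n → Unique (allVecs n)
allVecs-unique zero    = All.[] AllPairs.∷ AllPairs.[]
allVecs-unique (suc n) =
  cartesianProductWith⁺ _∷_ ∷-injective bools-unique (allVecs-unique n)

{-# OPTIONS --safe #-}

-- Read node 0 backwards in time: a configuration x of period p gives the
-- p-periodic word w i = (F^{-i} x)₀, and the node at distance m from node 0
-- along its circuit is in state w m, so w determines x.  Since p ∣ r, the
-- update rule of node 0 reads w i = ¬ w (i + ℓ) ∨ w i, that is
-- w i ∨ w (i + ℓ) = 1.  Hence C p ℓ r counts the p-periodic words satisfying
-- this constraint.  With d = gcd(ℓ,p) = gcd(ℓ′,p), every residue mod p is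
-- uniquely s + jℓ with 0 ≤ s < d and 0 ≤ j < p/d, and s + jℓ ↦ s + jℓ′ is a
-- permutation of ℤ/p that turns the shift by ℓ into the shift by ℓ′.
module Submission where

open import Defs
open import Data.Bool using (Bool; true; false; not; _∨_; if_then_else_)
open import Data.Fin using (Fin; zero; suc; toℕ; fromℕ; inject₁; _↑ˡ_; _↑ʳ_)
open import Data.Fin.Properties using (toℕ-inject₁; toℕ-fromℕ; toℕ-↑ˡ; toℕ-↑ʳ; injective⇒≤)
open import Data.List as List using (List; filter; length)
open import Data.List.Membership.Propositional using (_∈_)
open import Data.List.Membership.Propositional.Properties using (∈-filter⁺; ∈-filter⁻; ∈-lookup)
import Data.List.Relation.Unary.All as All
open import Data.List.Relation.Unary.AllPairs using (_∷_)
open import Data.List.Relation.Unary.Any using (index)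
open import Data.List.Relation.Unary.Any.Properties using (lookup-index)
open import Data.List.Relation.Unary.Unique.Propositional using (Unique)
open import Data.List.Relation.Unary.Unique.Propositional.Properties using (filter⁺)
open import Data.Nat using (ℕ; zero; suc; _+_; _*_; _∸_; _≤_; _<_; NonZero; ≢-nonZero; _≤?_; _≤ᵇ_; _≡ᵇ_; _≟_)
open import Data.Nat.DivMod using (_/_; _%_; m≡m%n+[m/n]*n; [m+kn]%n≡m%n; m%n%n≡m%n; m%n<n; m<n⇒m/n≡0; m*n/n≡m; +-distrib-/-∣ʳ)
open import Data.Nat.Divisibility using (_∣_; _∤_; divides; divides-refl)
open import Data.Nat.GCD using (gcd; gcd[m,n]∣m; gcd[m,n]∣n; gcd[m,n]≢0; gcd-GCD; module Bézout)
open import Data.Nat.GeneralisedArithmetic using (iterate)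
open import Data.Nat.Properties
open import Data.Nat.Tactic.RingSolver using (solve-∀)
open import Data.Product using (_×_; _,_; proj₂; ∃-syntax)
open import Data.Sum using (inj₂)
open import Data.Vec using (Vec; []; _∷_; head; last; take; drop; lookup; tabulate)
open import Data.Vec.Properties using (lookup∘tabulate; tabulate∘lookup; tabulate-cong)
open import Function using (_∘_)
open import Relation.Binary.Definitions using (tri<; tri≈; tri>)
open import Relation.Binary.PropositionalEquality using (_≡_; _≢_; _≗_; refl; sym; trans; cong; cong₂; subst; module ≡-Reasoning)
open import Relation.Nullary using (contradiction; yes; no)
open import Relation.Nullary.Decidable using (dec-true; dec-false)

open ≡-Reasoning

Word : Set
Word = ℕ → Bool

Periodic : ℕ → Word → Set
Periodic p w = ∀ i → w (i + p) ≡ w i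

Covered : ℕ → Word → Set
Covered ℓ w = ∀ i → w i ∨ w (i + ℓ) ≡ true

periodic-* : ∀ {p w} → Periodic p w → ∀ m a → w (a + m * p) ≡ w a
periodic-* {p} {w} per zero    a = cong w (+-identityʳ a)
periodic-* {p} {w} per (suc m) a = begin
  w (a + (p + m * p)) ≡⟨ cong w (sym (+-assoc a p (m * p))) ⟩
  w (a + p + m * p)   ≡⟨ periodic-* per m (a + p) ⟩
  w (a + p)           ≡⟨ per a ⟩
  w a                 ∎

periodic-cong : ∀ {p w} → Periodic p w → ∀ {a b} m n → a + m * p ≡ b + n * p → w a ≡ w b
periodic-cong {p} {w} per {a} {b} m n eq = begin
  w a           ≡⟨ sym (periodic-* per m a) ⟩
  w (a + m * p) ≡⟨ cong w eq ⟩
  w (b + n * p) ≡⟨ periodic-* per n b ⟩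
  w b           ∎

module _ {A : Set} (f : A → A) where

  iterate-+ : ∀ x m n → iterate f x (m + n) ≡ iterate f (iterate f x m) n
  iterate-+ x zero    n = refl
  iterate-+ x (suc m) n = iterate-+ (f x) m n

  iterate-suc : ∀ x n → iterate f x (suc n) ≡ f (iterate f x n)
  iterate-suc x zero    = refl
  iterate-suc x (suc n) = iterate-suc (f x) n

  iterate-* : ∀ {x p} → iterate f x p ≡ x → ∀ n → iterate f x (n * p) ≡ x
  iterate-* {x} {p} per zero    = refl
  iterate-* {x} {p} per (suc n) = begin
    iterate f x (p + n * p)           ≡⟨ iterate-+ x p (n * p) ⟩
    iterate f (iterate f x p) (n * p) ≡⟨ cong (λ y → iterate f y (n * p)) per ⟩
    iterate f x (n * p)               ≡⟨ iterate-* per n ⟩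
    x                                 ∎

  iterate-periodic : ∀ {x p} → iterate f x p ≡ x → ∀ n → iterate f (iterate f x n) p ≡ iterate f x n
  iterate-periodic {x} {p} per n = begin
    iterate f (iterate f x n) p ≡⟨ sym (iterate-+ x n p) ⟩
    iterate f x (n + p)         ≡⟨ cong (iterate f x) (+-comm n p) ⟩
    iterate f x (p + n)         ≡⟨ iterate-+ x p n ⟩
    iterate f (iterate f x p) n ≡⟨ cong (λ y → iterate f y n) per ⟩
    iterate f x n               ∎

module _ {A : Set} where

  head-lookup : ∀ {n} (xs : Vec A (suc n)) → head xs ≡ lookup xs zero
  head-lookup (x ∷ xs) = refl

  last-lookup : ∀ {n} (xs : Vec A (suc n)) → last xs ≡ lookup xs (fromℕ n)
  last-lookup (x ∷ [])     = refl
  last-lookup (x ∷ y ∷ xs) = last-lookup (y ∷ xs)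

  lookup-take : ∀ m {n} (xs : Vec A (m + n)) i → lookup (take m xs) i ≡ lookup xs (i ↑ˡ n)
  lookup-take (suc m) (x ∷ xs) zero    = refl
  lookup-take (suc m) (x ∷ xs) (suc i) = lookup-take m xs i

  lookup-drop : ∀ m {n} (xs : Vec A (m + n)) i → lookup (drop m xs) i ≡ lookup xs (m ↑ʳ i)
  lookup-drop zero    xs       i = refl
  lookup-drop (suc m) (x ∷ xs) i = lookup-drop m xs i

  lookup-ext : ∀ {n} {xs ys : Vec A n} → lookup xs ≗ lookup ys → xs ≡ ys
  lookup-ext {xs = xs} {ys} eq = begin
    xs                   ≡⟨ sym (tabulate∘lookup xs) ⟩
    tabulate (lookup xs) ≡⟨ tabulate-cong eq ⟩
    tabulate (lookup ys) ≡⟨ tabulate∘lookup ys ⟩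
    ys                   ∎

-- The distance from node 0 to node n along the circuit containing n, when the
-- left-circuit has l + 1 nodes.
depth : ℕ → ℕ → ℕ
depth l n = if n ≤ᵇ l then n else n ∸ l

depth-≤ : ∀ {l n} → n ≤ l → depth l n ≡ n
depth-≤ {l} {n} n≤l = cong (if_then n else n ∸ l) (dec-true (n ≤? l) n≤l)

depth-> : ∀ {l n} → l < n → depth l n ≡ n ∸ l
depth-> {l} {n} l<n = cong (if_then n else n ∸ l) (dec-false (n ≤? l) (<⇒≱ l<n))

depth-suc : ∀ {l n} → n ≢ l → depth l (suc n) ≡ suc (depth l n)
depth-suc {l} {n} n≢l with <-cmp n l
... | tri< n<l _ _ = trans (depth-≤ n<l) (cong suc (sym (depth-≤ (<⇒≤ n<l))))
... | tri≈ _ n≡l _ = contradiction n≡l n≢l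
... | tri> _ _ n>l = begin
  depth l (suc n)   ≡⟨ depth-> (m<n⇒m<1+n n>l) ⟩
  suc n ∸ l         ≡⟨ +-∸-assoc 1 (<⇒≤ n>l) ⟩
  suc (n ∸ l)       ≡⟨ cong suc (sym (depth-> n>l)) ⟩
  suc (depth l n)   ∎

depth-+ : ∀ l j → depth l (suc l + j) ≡ suc j
depth-+ l j = begin
  depth l (suc l + j) ≡⟨ depth-> (m≤m+n (suc l) j) ⟩
  suc l + j ∸ l       ≡⟨ cong (_∸ l) (sym (+-suc l j)) ⟩
  l + suc j ∸ l       ≡⟨ m+n∸m≡n l (suc j) ⟩
  suc j               ∎

module _ (l k : ℕ) where

  predecessor : ∀ (j : Fin (l + k)) →
    ∃[ q ] depth l (suc (toℕ j)) ≡ suc (depth l (toℕ q))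
         × (∀ y → lookup (F (suc l) (suc k) y) (suc j) ≡ lookup y q)
  predecessor j with toℕ j ≟ l
  ... | yes j≡l = zero , depth-eq , lookup-eq
    where
    depth-eq : depth l (suc (toℕ j)) ≡ 1
    depth-eq = begin
      depth l (suc (toℕ j)) ≡⟨ cong (depth l ∘ suc) (trans j≡l (sym (+-identityʳ l))) ⟩
      depth l (suc l + 0)   ≡⟨ depth-+ l 0 ⟩
      1                     ∎
    lookup-eq : ∀ y → lookup (F (suc l) (suc k) y) (suc j) ≡ lookup y zero
    lookup-eq y = begin
      lookup (F (suc l) (suc k) y) (suc j)
        ≡⟨ lookup∘tabulate _ j ⟩
      (if toℕ j ≡ᵇ l then head y else lookup y (inject₁ j))
        ≡⟨ cong (if_then head y else lookup y (inject₁ j)) (dec-true (toℕ j ≟ l) j≡l) ⟩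
      head y
        ≡⟨ head-lookup y ⟩
      lookup y zero ∎
  ... | no j≢l = inject₁ j , depth-eq , lookup-eq
    where
    depth-eq : depth l (suc (toℕ j)) ≡ suc (depth l (toℕ (inject₁ j)))
    depth-eq = trans (depth-suc j≢l) (cong (suc ∘ depth l) (sym (toℕ-inject₁ j)))
    lookup-eq : ∀ y → lookup (F (suc l) (suc k) y) (suc j) ≡ lookup y (inject₁ j)
    lookup-eq y = trans (lookup∘tabulate _ j)
      (cong (if_then head y else lookup y (inject₁ j)) (dec-false (toℕ j ≟ l) j≢l))

  lookup-iterate : ∀ m q → depth l (toℕ q) ≡ m →
                   ∀ y → lookup (iterate (F (suc l) (suc k)) y m) q ≡ head y
  lookup-iterate zero    zero    _  y = sym (head-lookup y)
  lookup-iterate (suc m) (suc j) eq y with predecessor j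
  ... | q , depth-eq , lookup-eq = begin
    lookup (iterate (F (suc l) (suc k)) y (suc m)) (suc j)
      ≡⟨ cong (λ z → lookup z (suc j)) (iterate-suc (F (suc l) (suc k)) y m) ⟩
    lookup (F (suc l) (suc k) (iterate (F (suc l) (suc k)) y m)) (suc j)
      ≡⟨ lookup-eq (iterate (F (suc l) (suc k)) y m) ⟩
    lookup (iterate (F (suc l) (suc k)) y m) q
      ≡⟨ lookup-iterate m q (suc-injective (trans (sym depth-eq) eq)) y ⟩
    head y ∎
  lookup-iterate zero    (suc j) eq y with predecessor j
  ... | q , depth-eq , _ = contradiction (trans (sym eq) depth-eq) 0≢1+n

  encode : Word → Config (suc l) (suc k)
  encode w = tabulate (w ∘ depth l ∘ toℕ)

  encode-cong : ∀ {v w} → v ≗ w → encode v ≡ encode w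
  encode-cong eq = tabulate-cong (eq ∘ depth l ∘ toℕ)

  lookup-encode : ∀ w q → lookup (encode w) q ≡ w (depth l (toℕ q))
  lookup-encode w = lookup∘tabulate (w ∘ depth l ∘ toℕ)

  last-left-encode : ∀ w → last (left (suc l) (suc k) (encode w)) ≡ w l
  last-left-encode w = begin
    last (take (suc l) (encode w))                  ≡⟨ last-lookup (take (suc l) (encode w)) ⟩
    lookup (take (suc l) (encode w)) (fromℕ l)      ≡⟨ lookup-take (suc l) (encode w) (fromℕ l) ⟩
    lookup (encode w) (fromℕ l ↑ˡ k)                ≡⟨ lookup-encode w (fromℕ l ↑ˡ k) ⟩
    w (depth l (toℕ (fromℕ l ↑ˡ k)))                ≡⟨ cong (w ∘ depth l) (trans (toℕ-↑ˡ (fromℕ l) k) (toℕ-fromℕ l)) ⟩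
    w (depth l l)                                   ≡⟨ cong w (depth-≤ ≤-refl) ⟩
    w l                                             ∎

-- The sharing of node 0 makes k = 0 special.
last-right-encode : ∀ l k w → last (right (suc l) (suc k) (encode l k w)) ≡ w k
last-right-encode l zero    w = last-lookup (right (suc l) 1 (encode l 0 w))
last-right-encode l (suc k) w = begin
  last (right (suc l) (2 + k) x)        ≡⟨ last-lookup (right (suc l) (2 + k) x) ⟩
  lookup (drop (suc l) x) (fromℕ k)     ≡⟨ lookup-drop (suc l) x (fromℕ k) ⟩
  lookup x (suc l ↑ʳ fromℕ k)           ≡⟨ lookup-encode l (suc k) w (suc l ↑ʳ fromℕ k) ⟩
  w (depth l (toℕ (suc l ↑ʳ fromℕ k)))  ≡⟨ cong (w ∘ depth l) (trans (toℕ-↑ʳ (suc l) (fromℕ k)) (cong (suc l +_) (toℕ-fromℕ k))) ⟩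
  w (depth l (suc l + k))               ≡⟨ cong w (depth-+ l k) ⟩
  w (suc k)                             ∎
  where x = encode l (suc k) w

head-F-encode : ∀ l k w → head (F (suc l) (suc k) (encode l k w)) ≡ not (w l) ∨ w k
head-F-encode l k w = cong₂ (λ a b → not a ∨ b) (last-left-encode l k w) (last-right-encode l k w)

module _ (p′ : ℕ) where

  private p = suc p′

  module _ (l k : ℕ) where

    private f = F (suc l) (suc k)

    -- p′ steps forward undo one step on a p-periodic orbit.
    decode : Config (suc l) (suc k) → Word
    decode x i = head (iterate f x (p′ * i))

    encode-decode : ∀ x → HasPeriod p (suc l) (suc k) x → encode l k (decode x) ≡ x
    encode-decode x per = lookup-ext λ q → let m = depth l (toℕ q) in begin
      lookup (encode l k (decode x)) q               ≡⟨ lookup-encode l k (decode x) q ⟩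
      head (iterate f x (p′ * m))                    ≡⟨ sym (lookup-iterate l k m q refl _) ⟩
      lookup (iterate f (iterate f x (p′ * m)) m) q  ≡⟨ cong (λ y → lookup y q) (sym (iterate-+ f x (p′ * m) m)) ⟩
      lookup (iterate f x (p′ * m + m)) q            ≡⟨ cong (λ n → lookup (iterate f x n) q) (arith p′ m) ⟩
      lookup (iterate f x (m * p)) q                 ≡⟨ cong (λ y → lookup y q) (iterate-* f per m) ⟩
      lookup x q                                     ∎
      where
      arith : ∀ p′ m → p′ * m + m ≡ m * suc p′
      arith = solve-∀

    decode-periodic : ∀ x → HasPeriod p (suc l) (suc k) x → Periodic p (decode x)
    decode-periodic x per i = cong head (begin
      iterate f x (p′ * (i + p))                 ≡⟨ cong (iterate f x) (arith p′ i) ⟩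
      iterate f x (p′ * p + p′ * i)              ≡⟨ iterate-+ f x (p′ * p) (p′ * i) ⟩
      iterate f (iterate f x (p′ * p)) (p′ * i)  ≡⟨ cong (λ y → iterate f y (p′ * i)) (iterate-* f per p′) ⟩
      iterate f x (p′ * i)                       ∎)
      where
      arith : ∀ p′ i → p′ * (i + suc p′) ≡ p′ * suc p′ + p′ * i
      arith = solve-∀

    decode-iterate : ∀ x n i → decode (iterate f x (p′ * n)) i ≡ decode x (n + i)
    decode-iterate x n i = cong head (begin
      iterate f (iterate f x (p′ * n)) (p′ * i)  ≡⟨ sym (iterate-+ f x (p′ * n) (p′ * i)) ⟩
      iterate f x (p′ * n + p′ * i)              ≡⟨ cong (iterate f x) (sym (*-distribˡ-+ p′ n i)) ⟩
      iterate f x (p′ * (n + i))                 ∎)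

    decode-update : ∀ x → HasPeriod p (suc l) (suc k) x →
                    ∀ i → decode x i ≡ not (decode x (i + suc l)) ∨ decode x (i + suc k)
    decode-update x per i = begin
      head (iterate f x (p′ * i))              ≡⟨ cong head (sym (iterate-periodic f {p = p} per (p′ * i))) ⟩
      head (iterate f (iterate f x (p′ * i)) p) ≡⟨ cong head (sym (iterate-+ f x (p′ * i) p)) ⟩
      head (iterate f x (p′ * i + p))          ≡⟨ cong (head ∘ iterate f x) (arith p′ i) ⟩
      head (iterate f x (suc (p′ * suc i)))    ≡⟨ cong head (iterate-suc f x (p′ * suc i)) ⟩
      head (f y)                               ≡⟨ cong (head ∘ f) (sym (encode-decode y (iterate-periodic f {p = p} per (p′ * suc i)))) ⟩
      head (f (encode l k (decode y)))         ≡⟨ head-F-encode l k (decode y) ⟩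
      not (decode y l) ∨ decode y k            ≡⟨ cong₂ (λ a b → not a ∨ b) (reindexed l) (reindexed k) ⟩
      not (decode x (i + suc l)) ∨ decode x (i + suc k) ∎
      where
      y = iterate f x (p′ * suc i)
      arith : ∀ p′ i → p′ * i + suc p′ ≡ suc (p′ * suc i)
      arith = solve-∀
      reindexed : ∀ n → decode y n ≡ decode x (i + suc n)
      reindexed n = trans (decode-iterate x (suc i) n) (cong (decode x) (sym (+-suc i n)))

    module _ (p∣r : p ∣ suc k) where

      decode-covered : ∀ x → HasPeriod p (suc l) (suc k) x → Covered (suc l) (decode x)
      decode-covered x per i = implication (decode x i) (decode x (i + suc l)) (begin
        decode x i                                        ≡⟨ decode-update x per i ⟩
        not (decode x (i + suc l)) ∨ decode x (i + suc k) ≡⟨ cong (not (decode x (i + suc l)) ∨_) (shift-r p∣r) ⟩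
        not (decode x (i + suc l)) ∨ decode x i           ∎)
        where
        implication : ∀ a b → a ≡ not b ∨ a → a ∨ b ≡ true
        implication true  b    eq = refl
        implication false true eq = refl
        shift-r : p ∣ suc k → decode x (i + suc k) ≡ decode x i
        shift-r (divides c eq) = trans (cong (λ n → decode x (i + n)) eq)
                                       (periodic-* (decode-periodic x per) c i)

      F-encode : ∀ {w} → Periodic p w → Covered (suc l) w →
                 f (encode l k w) ≡ encode l k (λ i → w (i + p′))
      F-encode {w} per cov = lookup-ext go
        where
        absorb : ∀ a b → b ∨ a ≡ true → not a ∨ b ≡ b
        absorb true  b    eq = refl
        absorb false true eq = refl
        cov′ : w p′ ∨ w l ≡ true
        cov′ = subst (λ b → w p′ ∨ b ≡ true)
          (trans (cong w (trans (+-comm p′ (suc l)) (sym (+-suc l p′)))) (per l)) (cov p′)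
        w-k : p ∣ suc k → w k ≡ w p′
        w-k (divides c eq) = periodic-cong per 1 c (begin
          k + 1 * p   ≡⟨ cong (k +_) (*-identityˡ p) ⟩
          k + suc p′  ≡⟨ +-suc k p′ ⟩
          suc k + p′  ≡⟨ cong (_+ p′) eq ⟩
          c * p + p′  ≡⟨ +-comm (c * p) p′ ⟩
          p′ + c * p  ∎)
        go : ∀ q → lookup (f (encode l k w)) q ≡ lookup (encode l k (λ i → w (i + p′))) q
        go zero = begin
          lookup (f (encode l k w)) zero  ≡⟨ sym (head-lookup (f (encode l k w))) ⟩
          head (f (encode l k w))         ≡⟨ head-F-encode l k w ⟩
          not (w l) ∨ w k                 ≡⟨ cong (not (w l) ∨_) (w-k p∣r) ⟩
          not (w l) ∨ w p′                ≡⟨ absorb (w l) (w p′) cov′ ⟩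
          w p′                            ∎
        go (suc j) with predecessor l k j
        ... | q , depth-eq , lookup-eq = begin
          lookup (f (encode l k w)) (suc j)                ≡⟨ lookup-eq (encode l k w) ⟩
          lookup (encode l k w) q                          ≡⟨ lookup-encode l k w q ⟩
          w (depth l (toℕ q))                              ≡⟨ sym (per (depth l (toℕ q))) ⟩
          w (depth l (toℕ q) + p)                          ≡⟨ cong w (+-suc (depth l (toℕ q)) p′) ⟩
          w (suc (depth l (toℕ q)) + p′)                   ≡⟨ cong (λ n → w (n + p′)) (sym depth-eq) ⟩
          w (depth l (suc (toℕ j)) + p′)                   ≡⟨ sym (lookup-encode l k (λ i → w (i + p′)) (suc j)) ⟩
          lookup (encode l k (λ i → w (i + p′))) (suc j)   ∎

      iterate-encode : ∀ n {w} → Periodic p w → Covered (suc l) w →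
                       iterate f (encode l k w) n ≡ encode l k (λ i → w (i + n * p′))
      iterate-encode zero    {w} per cov = encode-cong l k (λ i → cong w (sym (+-identityʳ i)))
      iterate-encode (suc n) {w} per cov = begin
        iterate f (f (encode l k w)) n                ≡⟨ cong (λ y → iterate f y n) (F-encode per cov) ⟩
        iterate f (encode l k v) n                    ≡⟨ iterate-encode n v-per v-cov ⟩
        encode l k (λ i → v (i + n * p′))             ≡⟨ encode-cong l k (λ i → cong w (arith i p′ n)) ⟩
        encode l k (λ i → w (i + suc n * p′))         ∎
        where
        v : Word
        v i = w (i + p′)
        arith : ∀ i p′ n → i + n * p′ + p′ ≡ i + suc n * p′
        arith = solve-∀
        swap : ∀ i a → i + a + p′ ≡ i + p′ + a
        swap i a = trans (+-assoc i a p′) (trans (cong (i +_) (+-comm a p′)) (sym (+-assoc i p′ a)))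
        v-per : Periodic p v
        v-per i = trans (cong w (swap i p)) (per (i + p′))
        v-cov : Covered (suc l) v
        v-cov i = trans (cong (λ n → v i ∨ w n) (swap i (suc l))) (cov (i + p′))

      encode-hasPeriod : ∀ {w} → Periodic p w → Covered (suc l) w →
                         HasPeriod p (suc l) (suc k) (encode l k w)
      encode-hasPeriod {w} per cov = trans (iterate-encode p per cov)
        (encode-cong l k (λ i → trans (cong (λ n → w (i + n)) (*-comm p p′)) (periodic-* per p′ i)))

      decode-encode : ∀ {w} → Periodic p w → Covered (suc l) w → decode (encode l k w) ≗ w
      decode-encode {w} per cov i = begin
        head (iterate f (encode l k w) (p′ * i))            ≡⟨ cong head (iterate-encode (p′ * i) per cov) ⟩
        w (p′ * i * p′)                                     ≡⟨ periodic-cong per (2 * i) (p * i) (arith p′ i) ⟩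
        w i                                                 ∎
        where
        arith : ∀ p′ i → p′ * i * p′ + 2 * i * suc p′ ≡ i + suc p′ * i * suc p′
        arith = solve-∀

bézout : ∀ ℓ p .{{_ : NonZero p}} → ∃[ k ] ∃[ a ] ∃[ b ] k * ℓ + a * p ≡ gcd ℓ p + b * p
bézout ℓ p@(suc p′) with Bézout.identity (gcd-GCD ℓ p)
... | Bézout.+- x y eq = x , 0 , y , trans (+-identityʳ (x * ℓ)) (sym eq)
... | Bézout.-+ x y eq = p′ * x , y , x * ℓ , (begin
  p′ * x * ℓ + y * p               ≡⟨ cong (p′ * x * ℓ +_) (sym eq) ⟩
  p′ * x * ℓ + (gcd ℓ p + x * ℓ)   ≡⟨ arith p′ x ℓ (gcd ℓ p) ⟩
  gcd ℓ p + x * ℓ * p              ∎)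
  where
  arith : ∀ p′ x ℓ d → p′ * x * ℓ + (d + x * ℓ) ≡ d + x * ℓ * suc p′
  arith = solve-∀

module _ (d : ℕ) .{{_ : NonZero d}} where

  -- If d = gcd ℓ p and kℓ ≡ d (mod p), then c = kℓ′ makes this the map
  -- s + jℓ ↦ s + jℓ′ modulo p.
  reindex : ℕ → ℕ → ℕ
  reindex c t = t % d + c * (t / d)

  reindex-+ : ∀ c t m → reindex c (t + m * d) ≡ reindex c t + c * m
  reindex-+ c t m = begin
    (t + m * d) % d + c * ((t + m * d) / d) ≡⟨ cong₂ (λ x y → x + c * y) ([m+kn]%n≡m%n t m d) quotient ⟩
    t % d + c * (t / d + m)                 ≡⟨ cong (t % d +_) (*-distribˡ-+ c (t / d) m) ⟩
    t % d + (c * (t / d) + c * m)           ≡⟨ sym (+-assoc (t % d) (c * (t / d)) (c * m)) ⟩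
    t % d + c * (t / d) + c * m             ∎
    where
    quotient : (t + m * d) / d ≡ t / d + m
    quotient = trans (+-distrib-/-∣ʳ t (divides-refl m)) (cong (t / d +_) (m*n/n≡m m d))

  reindex-% : ∀ c t → reindex c (t % d) ≡ t % d
  reindex-% c t = begin
    t % d % d + c * (t % d / d) ≡⟨ cong₂ (λ x y → x + c * y) (m%n%n≡m%n t d) (m<n⇒m/n≡0 (m%n<n t d)) ⟩
    t % d + c * 0               ≡⟨ cong (t % d +_) (*-zeroʳ c) ⟩
    t % d + 0                   ≡⟨ +-identityʳ (t % d) ⟩
    t % d                       ∎

  reindex-periodic : ∀ {p ℓ′} → d ∣ p → d ∣ ℓ′ → ∀ k {w} → Periodic p w → Periodic p (w ∘ reindex (k * ℓ′))
  reindex-periodic (divides-refl q) (divides-refl m′) k {w} per t = begin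
    w (reindex c (t + q * d))         ≡⟨ cong w (reindex-+ c t q) ⟩
    w (reindex c t + c * q)           ≡⟨ cong (λ n → w (reindex c t + n)) (arith k m′ d q) ⟩
    w (reindex c t + k * m′ * (q * d)) ≡⟨ periodic-* per (k * m′) (reindex c t) ⟩
    w (reindex c t)                   ∎
    where
    c = k * (m′ * d)
    arith : ∀ k m d q → k * (m * d) * q ≡ k * m * (q * d)
    arith = solve-∀

  reindex-shift : ∀ {p ℓ ℓ′} → d ∣ ℓ → d ∣ ℓ′ → ∀ k a b → k * ℓ + a * p ≡ d + b * p →
                  ∀ {w} → Periodic p w → ∀ t → w (reindex (k * ℓ′) (t + ℓ)) ≡ w (reindex (k * ℓ′) t + ℓ′)
  reindex-shift {p} (divides-refl m) (divides-refl m′) k a b kℓ≡d {w} per t = periodic-cong per (m′ * a) (m′ * b) (begin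
    reindex c (t + m * d) + m′ * a * p              ≡⟨ cong (_+ m′ * a * p) (reindex-+ c t m) ⟩
    reindex c t + k * (m′ * d) * m + m′ * a * p     ≡⟨ arith₁ (reindex c t) k m′ d m a p ⟩
    reindex c t + m′ * (k * (m * d) + a * p)        ≡⟨ cong (λ n → reindex c t + m′ * n) kℓ≡d ⟩
    reindex c t + m′ * (d + b * p)                  ≡⟨ arith₂ (reindex c t) m′ d b p ⟩
    reindex c t + m′ * d + m′ * b * p               ∎)
    where
    c = k * (m′ * d)
    arith₁ : ∀ x k m′ d m a p → x + k * (m′ * d) * m + m′ * a * p ≡ x + m′ * (k * (m * d) + a * p)
    arith₁ = solve-∀
    arith₂ : ∀ x m′ d b p → x + m′ * (d + b * p) ≡ x + m′ * d + m′ * b * p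
    arith₂ = solve-∀

  reindex-covered : ∀ {p ℓ ℓ′} → d ∣ ℓ → d ∣ ℓ′ → ∀ k a b → k * ℓ + a * p ≡ d + b * p →
                    ∀ {w} → Periodic p w → Covered ℓ′ w → Covered ℓ (w ∘ reindex (k * ℓ′))
  reindex-covered {ℓ′ = ℓ′} d∣ℓ d∣ℓ′ k a b kℓ≡d {w} per cov t =
    trans (cong (w (reindex (k * ℓ′) t) ∨_) (reindex-shift d∣ℓ d∣ℓ′ k a b kℓ≡d per t)) (cov (reindex (k * ℓ′) t))

  reindex-inverse : ∀ {p ℓ ℓ′} → d ∣ ℓ → d ∣ ℓ′ → ∀ k a b → k * ℓ + a * p ≡ d + b * p →
                    ∀ k′ a′ b′ → k′ * ℓ′ + a′ * p ≡ d + b′ * p →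
                    ∀ {w} → Periodic p w → w ∘ reindex (k * ℓ′) ∘ reindex (k′ * ℓ) ≗ w
  reindex-inverse {p} (divides-refl m) (divides-refl m′) k a b kℓ≡d k′ a′ b′ k′ℓ′≡d {w} per t =
    periodic-cong per (j * k′ * m′ * a + j * a′) (j * k′ * m′ * b + j * b′) (begin
      reindex c (s + k′ * (m * d) * j) + (j * k′ * m′ * a + j * a′) * p
        ≡⟨ cong (λ n → reindex c n + (j * k′ * m′ * a + j * a′) * p) (cong (s +_) (arith₀ k′ m d j)) ⟩
      reindex c (s + k′ * m * j * d) + (j * k′ * m′ * a + j * a′) * p
        ≡⟨ cong (_+ (j * k′ * m′ * a + j * a′) * p) (trans (reindex-+ c s (k′ * m * j)) (cong (_+ c * (k′ * m * j)) (reindex-% c t))) ⟩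
      s + k * (m′ * d) * (k′ * m * j) + (j * k′ * m′ * a + j * a′) * p
        ≡⟨ arith₁ s k m′ d k′ m j a a′ p ⟩
      s + j * k′ * m′ * (k * (m * d) + a * p) + j * a′ * p
        ≡⟨ cong (λ n → s + j * k′ * m′ * n + j * a′ * p) kℓ≡d ⟩
      s + j * k′ * m′ * (d + b * p) + j * a′ * p
        ≡⟨ arith₂ s j k′ m′ d b p a′ ⟩
      s + j * (k′ * (m′ * d) + a′ * p) + j * k′ * m′ * b * p
        ≡⟨ cong (λ n → s + j * n + j * k′ * m′ * b * p) k′ℓ′≡d ⟩
      s + j * (d + b′ * p) + j * k′ * m′ * b * p
        ≡⟨ arith₃ s j d b′ p (j * k′ * m′ * b) ⟩
      s + j * d + (j * k′ * m′ * b + j * b′) * p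
        ≡⟨ cong (_+ (j * k′ * m′ * b + j * b′) * p) (sym (m≡m%n+[m/n]*n t d)) ⟩
      t + (j * k′ * m′ * b + j * b′) * p ∎)
    where
    c = k * (m′ * d)
    s = t % d
    j = t / d
    arith₀ : ∀ k′ m d j → k′ * (m * d) * j ≡ k′ * m * j * d
    arith₀ = solve-∀
    arith₁ : ∀ s k m′ d k′ m j a a′ p →
             s + k * (m′ * d) * (k′ * m * j) + (j * k′ * m′ * a + j * a′) * p ≡
             s + j * k′ * m′ * (k * (m * d) + a * p) + j * a′ * p
    arith₁ = solve-∀
    arith₂ : ∀ s j k′ m′ d b p a′ →
             s + j * k′ * m′ * (d + b * p) + j * a′ * p ≡
             s + j * (k′ * (m′ * d) + a′ * p) + j * k′ * m′ * b * p
    arith₂ = solve-∀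
    arith₃ : ∀ s j d b′ p x → s + j * (d + b′ * p) + x * p ≡ s + j * d + (x + j * b′) * p
    arith₃ = solve-∀

lookup-injective : ∀ {A : Set} {xs : List A} → Unique xs →
                   ∀ i j → List.lookup xs i ≡ List.lookup xs j → i ≡ j
lookup-injective (x∉xs ∷ _) zero    zero    _  = refl
lookup-injective (x∉xs ∷ _) zero    (suc j) eq = contradiction eq (All.lookup x∉xs (∈-lookup j))
lookup-injective (x∉xs ∷ _) (suc i) zero    eq = contradiction (sym eq) (All.lookup x∉xs (∈-lookup i))
lookup-injective (_ ∷ uniq) (suc i) (suc j) eq = cong suc (lookup-injective uniq i j eq)

unique⇒length-≤ : ∀ {A B : Set} {xs : List A} {ys : List B} → Unique xs →
                  (f : A → B) (g : B → A) →
                  (∀ {x} → x ∈ xs → f x ∈ ys) → (∀ {x} → x ∈ xs → g (f x) ≡ x) →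
                  length xs ≤ length ys
unique⇒length-≤ {xs = xs} {ys} uniq f g f∈ys g∘f = injective⇒≤ injective
  where
  position : Fin (length xs) → Fin (length ys)
  position i = index (f∈ys (∈-lookup i))
  lookup-position : ∀ i → g (List.lookup ys (position i)) ≡ List.lookup xs i
  lookup-position i = trans (cong g (sym (lookup-index (f∈ys (∈-lookup i))))) (g∘f (∈-lookup i))
  injective : ∀ {i j} → position i ≡ position j → i ≡ j
  injective {i} {j} eq = lookup-injective uniq i j
    (trans (sym (lookup-position i)) (trans (cong (g ∘ List.lookup ys) eq) (lookup-position j)))

C-≤ : ∀ (p : ℕ) .{{_ : NonZero p}}
      (ℓ r ℓ′ r′ : ℕ) .{{_ : NonZero ℓ}} .{{_ : NonZero r}}
      .{{_ : NonZero ℓ′}} .{{_ : NonZero r′}} →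
      p ∣ r → p ∣ r′ → gcd ℓ p ≡ gcd ℓ′ p → C p ℓ r ≤ C p ℓ′ r′
C-≤ p@(suc p′) ℓ@(suc l) r@(suc k) ℓ′@(suc l′) r′@(suc k′) p∣r p∣r′ gcd≡
  with bézout ℓ p | bézout ℓ′ p
... | c , a , b , cℓ≡d | c′ , a′ , b′ , c′ℓ′≡d′ =
  unique⇒length-≤ (filter⁺ (hasPeriod? p ℓ r) (allVecs-unique (ℓ + k))) transfer transfer⁻¹
    (λ x∈ → ∈-filter⁺ (hasPeriod? p ℓ′ r′) (∈-allVecs _) (transfer-hasPeriod (periodic x∈)))
    (λ x∈ → transfer⁻¹∘transfer (periodic x∈))
  where
  d : ℕ
  d = gcd ℓ p
  instance
    d≢0 : NonZero d
    d≢0 = ≢-nonZero (gcd[m,n]≢0 ℓ p (inj₂ 1+n≢0))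
  d∣p : d ∣ p
  d∣p = gcd[m,n]∣n ℓ p
  d∣ℓ : d ∣ ℓ
  d∣ℓ = gcd[m,n]∣m ℓ p
  d∣ℓ′ : d ∣ ℓ′
  d∣ℓ′ = subst (_∣ ℓ′) (sym gcd≡) (gcd[m,n]∣m ℓ′ p)
  c′ℓ′≡d : c′ * ℓ′ + a′ * p ≡ d + b′ * p
  c′ℓ′≡d = trans c′ℓ′≡d′ (cong (_+ b′ * p) (sym gcd≡))

  periodic : ∀ {x} → x ∈ filter (hasPeriod? p ℓ r) (allVecs (ℓ + k)) → HasPeriod p ℓ r x
  periodic x∈ = proj₂ (∈-filter⁻ (hasPeriod? p ℓ r) {xs = allVecs (ℓ + k)} x∈)

  word : Config ℓ r → Word
  word x = decode p′ l k x ∘ reindex d (c′ * ℓ)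

  transfer : Config ℓ r → Config ℓ′ r′
  transfer x = encode l′ k′ (word x)

  transfer⁻¹ : Config ℓ′ r′ → Config ℓ r
  transfer⁻¹ y = encode l k (decode p′ l′ k′ y ∘ reindex d (c * ℓ′))

  module _ {x : Config ℓ r} (per : HasPeriod p ℓ r x) where

    word-periodic : Periodic p (word x)
    word-periodic = reindex-periodic d d∣p d∣ℓ c′ (decode-periodic p′ l k x per)

    word-covered : Covered ℓ′ (word x)
    word-covered = reindex-covered d d∣ℓ′ d∣ℓ c′ a′ b′ c′ℓ′≡d
      (decode-periodic p′ l k x per) (decode-covered p′ l k p∣r x per)

    transfer-hasPeriod : HasPeriod p ℓ′ r′ (transfer x)
    transfer-hasPeriod = encode-hasPeriod p′ l′ k′ p∣r′ word-periodic word-covered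

    transfer⁻¹∘transfer : transfer⁻¹ (transfer x) ≡ x
    transfer⁻¹∘transfer = trans
      (encode-cong l k λ t → trans
        (decode-encode p′ l′ k′ p∣r′ word-periodic word-covered (reindex d (c * ℓ′) t))
        (reindex-inverse d d∣ℓ′ d∣ℓ c′ a′ b′ c′ℓ′≡d c a b cℓ≡d (decode-periodic p′ l k x per) t))
      (encode-decode p′ l k x per)

lemma1 : ∀ (p : ℕ) .{{_ : NonZero p}}
    (ℓ r ℓ′ r′ : ℕ) .{{_ : NonZero ℓ}} .{{_ : NonZero r}}
    .{{_ : NonZero ℓ′}} .{{_ : NonZero r′}} →
    p ∣ r → p ∤ ℓ → p ∣ r′ → p ∤ ℓ′ →
    gcd ℓ p ≡ gcd ℓ′ p → C p ℓ r ≡ C p ℓ′ r′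
lemma1 p ℓ r ℓ′ r′ p∣r _ p∣r′ _ gcd≡ =
  ≤-antisym (C-≤ p ℓ r ℓ′ r′ p∣r p∣r′ gcd≡) (C-≤ p ℓ′ r′ ℓ r p∣r′ p∣r (sym gcd≡))
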